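{- Let $\{a,b,c\}$ with $a<b<c$ and $\{a',b',c'\}$ with $a'<b'<c'$ be $D(4)$-triples for which the associated triangles exist, and let these triangles have side-length triples $(r,s,t)$ and $(r',s',t')$, respectively. If the two triangles are similar, then they are congruent.
   Context: A $D(4)$-triple is a set of three distinct positive integers such that the product of any two distinct elements, increased by $4$, is a perfect square. For a $D(4)$-triple $\{a,b,c\}$ with $a<b<c$, put $r=\sqrt{ab+4}$, $s=\sqrt{ac+4}$, $t=\sqrt{bc+4}$; these are positive integers with $r<s<t$. If $r+s>t$, the (non-degenerate) triangle with side lengths $r,s,t$ is called the triangle associated with the $D(4)$-triple $\{a,b,c\}$, and $(r,s,t)$ is its side-length triple; if $r+s\le t$, the associated triangle does not exist. For $\{a',b',c'\}$ the quantities $r',s',t'$ are defined in the same way. -}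

module Defs where

open import Data.Fin.Permutation using (Permutation′; _⟨$⟩ʳ_)
open import Data.Integer using (+_)
open import Data.Nat as ℕ using (ℕ)
open import Data.Product using (∃; ∃-syntax; _×_)
open import Data.Rational as ℚ using (ℚ; Positive)
open import Data.Vec.Functional using (Vector; []; _∷_)
open import Relation.Binary.PropositionalEquality using (_≡_; _≢_)

IsPerfectSquare : ℕ → Set
IsPerfectSquare n = ∃[ k ] k ℕ.* k ≡ n

record IsD4Triple (a b c : ℕ) : Set where
  field
    a-positive : 0 ℕ.< a
    b-positive : 0 ℕ.< b
    c-positive : 0 ℕ.< c
    a≢b        : a ≢ b
    a≢c        : a ≢ c
    b≢c        : b ≢ c
    ab+4       : IsPerfectSquare (a ℕ.* b ℕ.+ 4)
    ac+4       : IsPerfectSquare (a ℕ.* c ℕ.+ 4)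
    bc+4       : IsPerfectSquare (b ℕ.* c ℕ.+ 4)

-- r = √(ab+4), s = √(ac+4), t = √(bc+4), where m = √n is rendered as m * m ≡ n,
-- which determines the natural number m uniquely.  The field `exists` is the
-- condition under which the associated triangle exists; for a < b < c the two
-- other triangle inequalities follow from r < s < t.
record IsAssociatedTriangle (a b c r s t : ℕ) : Set where
  field
    isD4Triple : IsD4Triple a b c
    a<b        : a ℕ.< b
    b<c        : b ℕ.< c
    r≡√        : r ℕ.* r ≡ a ℕ.* b ℕ.+ 4
    s≡√        : s ℕ.* s ≡ a ℕ.* c ℕ.+ 4
    t≡√        : t ℕ.* t ≡ b ℕ.* c ℕ.+ 4
    exists     : t ℕ.< r ℕ.+ s

-- A triangle with integer side lengths, up to its position in the plane.
Sides : Set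
Sides = Vector ℕ 3

sides : ℕ → ℕ → ℕ → Sides
sides x y z = x ∷ y ∷ z ∷ []

-- Triangles are similar when, under some correspondence σ of their sides,
-- corresponding sides are in a common ratio k.  For positive integer lengths
-- such a ratio is automatically rational.
Similar : Sides → Sides → Set
Similar T T′ =
  ∃ λ (σ : Permutation′ 3) → ∃ λ (k : ℚ) → Positive k ×
    (∀ i → (+ T′ (σ ⟨$⟩ʳ i)) ℚ./ 1 ≡ k ℚ.* ((+ T i) ℚ./ 1))

Congruent : Sides → Sides → Set
Congruent T T′ = ∃ λ (σ : Permutation′ 3) → ∀ i → T′ (σ ⟨$⟩ʳ i) ≡ T i

{-# OPTIONS --safe #-}
module Submission where

-- If the triangle of {a, b, c} exists then c = a + b + 2r, so its sides are r, a + r, b + r: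
-- otherwise c > ab + a + b, except for the pairs {3, 4} and {a, a + 4} treated directly, and
-- such a c forces t ≥ r + s.  A similarity then scales a, b and r by one common factor k, and
-- r² − ab = 4 = k² (r² − ab) gives k = 1.

open import Defs
open import Data.Empty using (⊥; ⊥-elim)
open import Data.Fin as Fin using (Fin; zero; suc; toℕ; fromℕ<)
open import Data.Fin.Permutation as Permutation using (_⟨$⟩ʳ_)
open import Data.Fin.Properties using (all?; toℕ-fromℕ<)
open import Data.Integer as ℤ using (+[1+_])
import Data.Integer.Properties as ℤ
open import Data.Nat using (ℕ; zero; suc; _+_; _*_; _≤_; _<_; z≤n; s≤s; z<s; >-nonZero)
open import Data.Nat.Properties
open import Data.Nat.Tactic.RingSolver using (solve-∀)
open import Data.Product using (∃-syntax; _×_; _,_)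
open import Data.Rational as ℚ using (mkℚ; Positive; toℚᵘ)
open import Data.Rational.Properties using (toℚᵘ-homo-*; toℚᵘ-cong; toℚᵘ-fromℚᵘ)
open import Data.Rational.Unnormalised as ℚᵘ using (mkℚᵘ; *≡*)
import Data.Rational.Unnormalised.Properties as ℚᵘ
open import Data.Sum using (_⊎_; inj₁; inj₂)
open import Relation.Binary.Definitions using (tri<; tri≈; tri>)
open import Relation.Binary.PropositionalEquality
open import Relation.Nullary using (¬_)
open import Relation.Nullary.Decidable using (from-yes; _→-dec_; _×-dec_; _⊎-dec_)

-- Order and parity of squares.

≤-witness : ∀ {m n} k → n ≡ m + k → m ≤ n
≤-witness k refl = m≤m+n _ k

square-mono-< : ∀ {m n} → m < n → m * m < n * n
square-mono-< m<n = *-mono-< m<n m<n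

square-cancel-≤ : ∀ {m n} → m * m ≤ n * n → m ≤ n
square-cancel-≤ m²≤n² = ≮⇒≥ λ n<m → <⇒≱ (square-mono-< n<m) m²≤n²

square-injective : ∀ {m n} → m * m ≡ n * n → m ≡ n
square-injective m²≡n² =
  ≤-antisym (square-cancel-≤ (≤-reflexive m²≡n²)) (square-cancel-≤ (≤-reflexive (sym m²≡n²)))

even⊎odd : ∀ n → (∃[ j ] n ≡ 2 * j) ⊎ (∃[ j ] n ≡ suc (2 * j))
even⊎odd zero = inj₁ (0 , refl)
even⊎odd (suc n) with even⊎odd n
... | inj₁ (j , refl) = inj₂ (j , refl)
... | inj₂ (j , refl) = inj₁ (suc j , sym (*-suc 2 j))

-- An odd difference `n` - `m` would make n² - m² odd, but it is a multiple of 4.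
square-gap : ∀ {m n k} → n * n ≡ m * m + 4 * k → ∃[ j ] n ≡ m + 2 * j
square-gap {m} {n} {k} n² with m≤n⇒∃[o]m+o≡n (square-cancel-≤ {m} {n} (≤-witness _ n²))
... | d , refl with even⊎odd d
... | inj₁ (j , refl) = j , refl
... | inj₂ (j , refl) = ⊥-elim (even≢odd (2 * k) (m * suc (2 * j) + 2 * j * j + 2 * j)
    (+-cancelˡ-≡ (m * m) _ _ odd-square))
  where
  expand : ∀ m j → (m + suc (2 * j)) * (m + suc (2 * j)) ≡
    m * m + suc (2 * (m * suc (2 * j) + 2 * j * j + 2 * j))
  expand = solve-∀
  quadruple : ∀ m k → m * m + 4 * k ≡ m * m + 2 * (2 * k)
  quadruple = solve-∀
  odd-square = trans (sym (quadruple m k)) (trans (sym n²) (expand m j))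

-- Pairs {a, b} sorted by the gap between them.

-- Here b = a + d and r = a + g, so the hypothesis is r² = ab + 4 with a² cancelled.
gap-cases : ∀ {a d g} → 0 < a → 0 < d → a * (2 * g) + g * g ≡ a * d + 4 →
  (a ≡ 3 × d ≡ 1) ⊎ (d ≡ 4 × g ≡ 2) ⊎ 2 * (a + (a + d)) + 15 ≤ d * d
gap-cases {a} {d} {g} 0<a 0<d eq with ≤-total (2 * g) d
... | inj₁ 2g≤d with m≤n⇒∃[o]m+o≡n 2g≤d
...   | m , refl = wide m (+-cancelˡ-≡ (a * (2 * g)) _ _ (trans eq (distrib a g m)))
  where
  distrib : ∀ a g m → a * (2 * g + m) + 4 ≡ a * (2 * g) + (a * m + 4)
  distrib = solve-∀
  -- Writing d = 2g + m turns the hypothesis into g² = am + 4: m = 0 yields the gap 4, and every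
  -- larger m a wide gap.
  wide : ∀ m → g * g ≡ a * m + 4 →
    (a ≡ 3 × 2 * g + m ≡ 1) ⊎ (2 * g + m ≡ 4 × g ≡ 2) ⊎
    2 * (a + (a + (2 * g + m))) + 15 ≤ (2 * g + m) * (2 * g + m)
  wide zero g² with square-injective {g} {2} (trans g² (cong (_+ 4) (*-zeroʳ a)))
  ... | refl = inj₂ (inj₁ (refl , refl))
  -- The witness vanishes when d = 2g + 1, so 15 is the largest constant possible here.
  wide (suc m) g² = inj₂ (inj₂ (≤-witness (4 * a * m + 4 * g * m + m * m)
    (trans (expand g m)
      (trans (cong (λ x → 4 * x + (4 * g * suc m + suc m * suc m)) g²) (compare a g m)))))
    where
    expand : ∀ g m → (2 * g + suc m) * (2 * g + suc m) ≡
      4 * (g * g) + (4 * g * suc m + suc m * suc m)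
    expand = solve-∀
    compare : ∀ a g m → 4 * (a * suc m + 4) + (4 * g * suc m + suc m * suc m) ≡
      2 * (a + (a + (2 * g + suc m))) + 15 + (4 * a * m + 4 * g * m + m * m)
    compare = solve-∀
gap-cases {suc a} {suc d} {g} _ _ eq | inj₂ d≤2g with m≤n⇒∃[o]m+o≡n d≤2g
... | m , d+m≡2g = narrow m g d+m≡2g (+-cancelˡ-≡ (suc a * suc d) _ _
    (trans (distrib a d m (g * g)) (trans (cong (λ x → suc a * x + g * g) d+m≡2g) eq)))
  where
  distrib : ∀ a d m x → suc a * suc d + (suc a * m + x) ≡ suc a * (suc d + m) + x
  distrib = solve-∀
  -- With 2g = d + m the equation becomes am + g² = 4. Either m = 0 and g = 2, or g = 1, am = 3 and
  -- d + m = 2, so that m = d = 1.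
  narrow : ∀ m g → suc d + m ≡ 2 * g → suc a * m + g * g ≡ 4 →
    (suc a ≡ 3 × suc d ≡ 1) ⊎ (suc d ≡ 4 × g ≡ 2) ⊎
    2 * (suc a + (suc a + suc d)) + 15 ≤ suc d * suc d
  narrow zero g d≡2g g² with square-injective {g} {2} (trans (cong (_+ g * g) (sym (*-zeroʳ a))) g²)
  ... | refl = inj₂ (inj₁ (trans (sym (+-identityʳ (suc d))) d≡2g , refl))
  narrow (suc m) 1 d+m≡1 a+1≡4 =
    inj₁ (trans (sym (*-identityʳ (suc a))) (subst (λ x → suc a * suc x ≡ 3) (m+n≡0⇒n≡0 d d+m≡0)
        (+-cancelʳ-≡ 1 (suc a * suc m) 3 a+1≡4)) , cong suc (m+n≡0⇒m≡0 d d+m≡0))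
    where
    d+m≡0 : d + m ≡ 0
    d+m≡0 = suc-injective (trans (sym (+-suc d m)) (suc-injective d+m≡1))
  narrow (suc m) (suc (suc g)) _ g² =
    ⊥-elim (m+1+n≢m 4 (trans (sym (expand a m g)) g²))
    where
    expand : ∀ a m g → suc a * suc m + suc (suc g) * suc (suc g) ≡
      4 + suc (a + m + a * m + 4 * g + g * g)
    expand = solve-∀

gap-product : ∀ a d → a * (a + d) + 4 ≡ a * a + (a * d + 4)
gap-product = solve-∀

-- The outcomes call for different arguments about c: a Pell equation for {3, 4}, a factorisation
-- for {a, a + 4}, and size estimates for a wide gap.
pair-cases : ∀ {a b r} → 0 < a → a < b → r * r ≡ a * b + 4 →
  (a ≡ 3 × b ≡ 4) ⊎ (b ≡ a + 4 × r ≡ a + 2) ⊎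
  (∃[ d ] b ≡ a + d × 2 * (a + (a + d)) + 15 ≤ d * d)
pair-cases {a} {b} {r} 0<a a<b r² with m≤n⇒∃[o]m+o≡n (<⇒≤ a<b)
... | d , refl with m≤n⇒∃[o]m+o≡n
      (square-cancel-≤ {a} {r} (≤-witness (a * d + 4) (trans r² (gap-product a d))))
... | g , refl with gap-cases {a} {d} {g} 0<a 0<d
      (+-cancelˡ-≡ (a * a) _ _ (trans (sym (left a g)) (trans r² (gap-product a d))))
  where
  0<d : 0 < d
  0<d = +-cancelˡ-< a 0 d (subst (_< a + d) (sym (+-identityʳ a)) a<b)
  left : ∀ a g → (a + g) * (a + g) ≡ a * a + (a * (2 * g) + g * g)
  left = solve-∀
...   | inj₁ (refl , refl) = inj₁ (refl , refl)
...   | inj₂ (inj₁ (refl , refl)) = inj₂ (inj₁ (refl , refl))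
...   | inj₂ (inj₂ d²) = inj₂ (inj₂ (d , refl , d²))

-- The third element over {3, 4} and over {a, a + 4}.

-- The bound on `u` stops just short of u = 15, s = 26, the next solution of s² - 3u² = 1; the
-- remaining box is searched exhaustively.
pell-solutions : ∀ {u s} → u < 15 → s < 27 → s * s ≡ 3 * (u * u) + 1 → u ≤ 1 ⊎ u ≡ 4
pell-solutions {u} {s} u<15 s<27 eq =
  subst (λ x → x ≤ 1 ⊎ x ≡ 4) (toℕ-fromℕ< u<15)
    (search (fromℕ< u<15) (fromℕ< s<27)
      (subst₂ (λ x y → y * y ≡ 3 * (x * x) + 1) (sym (toℕ-fromℕ< u<15)) (sym (toℕ-fromℕ< s<27)) eq))
  where
  search : ∀ (i : Fin 15) (j : Fin 27) →
    toℕ j * toℕ j ≡ 3 * (toℕ i * toℕ i) + 1 → toℕ i ≤ 1 ⊎ toℕ i ≡ 4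
  search = from-yes (all? {n = 15} λ i → all? {n = 27} λ j →
    (toℕ j * toℕ j ≟ 3 * (toℕ i * toℕ i) + 1) →-dec ((toℕ i ≤? 1) ⊎-dec (toℕ i ≟ 4)))

-- Here r = 4 and t = 2u, so c = u² - 1 and s² = 3u² + 1. The triangle inequality 2u < 4 + s bounds
-- u, because s grows only like √3 u.
third-of-3-4 : ∀ {c s t} → 0 < c → s * s ≡ 3 * c + 4 → t * t ≡ 4 * c + 4 → t < 4 + s → c ≡ 15
third-of-3-4 {c} {s} {t} 0<c s² t² t<4+s with square-gap {0} {t} {c + 1} (trans t² (sym (*-distribˡ-+ 4 c 1)))
... | u , refl = conclude (pell-solutions u<15 s<27 s²≡3u²+1)
  where
  u²≡c+1 : u * u ≡ c + 1
  u²≡c+1 = *-cancelˡ-≡ (u * u) (c + 1) 4 (trans (expand u) (trans t² (sym (*-distribˡ-+ 4 c 1))))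
    where
    expand : ∀ u → 4 * (u * u) ≡ 2 * u * (2 * u)
    expand = solve-∀

  s²≡3u²+1 : s * s ≡ 3 * (u * u) + 1
  s²≡3u²+1 = trans s² (trans (shift c) (cong (λ x → 3 * x + 1) (sym u²≡c+1)))
    where
    shift : ∀ c → 3 * c + 4 ≡ 3 * (c + 1) + 1
    shift = solve-∀

  -- For u = 15 + v the triangle inequality gives s ≥ 2u - 3 = 27 + 2v, whose square already exceeds
  -- 3u² + 1.
  u<15 : u < 15
  u<15 = ≰⇒> λ 15≤u → large (m≤n⇒∃[o]m+o≡n 15≤u)
    where
    large : (∃[ v ] 15 + v ≡ u) → ⊥
    large (v , refl) = <⇒≱ (≤-witness (v * v + 18 * v + 52) (gap v))
      (subst ((27 + 2 * v) * (27 + 2 * v) ≤_) s²≡3u²+1 (*-mono-≤ 27+2v≤s 27+2v≤s))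
      where
      gap : ∀ v → (27 + 2 * v) * (27 + 2 * v) ≡ suc (3 * ((15 + v) * (15 + v)) + 1) + (v * v + 18 * v + 52)
      gap = solve-∀
      shift : ∀ v → 4 + (27 + 2 * v) ≡ suc (2 * (15 + v))
      shift = solve-∀
      27+2v≤s : 27 + 2 * v ≤ s
      27+2v≤s = +-cancelˡ-≤ 4 _ _ (subst (_≤ 4 + s) (sym (shift v)) t<4+s)

  s<27 : s < 27
  -- As u ≤ 14, s² is at most 589, and 27² = 590 + 139.
  s<27 = ≰⇒> λ 27≤s → <⇒≱ {3 * (u * u) + 1} {27 * 27}
    (≤-trans (s≤s (+-monoˡ-≤ 1 (*-monoʳ-≤ 3 (*-mono-≤ (≤-pred u<15) (≤-pred u<15))))) (≤-witness 139 refl))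
    (subst (27 * 27 ≤_) s²≡3u²+1 (*-mono-≤ 27≤s 27≤s))

  conclude : u ≤ 1 ⊎ u ≡ 4 → c ≡ 15
  conclude (inj₂ u≡4) = +-cancelʳ-≡ 1 c 15 (trans (sym u²≡c+1) (cong (λ x → x * x) u≡4))
  conclude (inj₁ u≤1) = ⊥-elim (<⇒≱ 0<c (+-cancelʳ-≤ 1 c 0 (subst (_≤ 1) u²≡c+1 (*-mono-≤ u≤1 u≤1))))

-- With t = s + 2j and c = js + j², the equation s² = ac + 4 factors as s (s − aj) = aj² + 4;
-- writing s = aj + v, only v = j is possible.
gap-4-root : ∀ {a j s} → 0 < a → 0 < j → 2 * j < a + 2 → s * s ≡ a * (j * s + j * j) + 4 →
  j ≡ 2 × s ≡ a * 2 + 2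
gap-4-root {a} {j} {s} 0<a 0<j 2j<a+2 s² with m≤n⇒∃[o]m+o≡n (≮⇒≥ s≮aj)
  where
  s≮aj : ¬ s < a * j
  s≮aj s<aj = <⇒≱ (≤-witness (a * (j * j) + 3) (trans s² (expand a s j))) (*-monoˡ-≤ s (<⇒≤ s<aj))
    where
    expand : ∀ a s j → a * (j * s + j * j) + 4 ≡ suc (a * j * s) + (a * (j * j) + 3)
    expand = solve-∀
... | v , refl = compare (<-cmp v j)
  where
  v² : a * (j * v) + v * v ≡ a * (j * j) + 4
  v² = +-cancelˡ-≡ (a * j * (a * j + v)) _ _ (trans (left a j v) (trans s² (right a j v)))
    where
    left : ∀ a j v → a * j * (a * j + v) + (a * (j * v) + v * v) ≡ (a * j + v) * (a * j + v)
    left = solve-∀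
    right : ∀ a j v → a * (j * (a * j + v) + j * j) + 4 ≡ a * j * (a * j + v) + (a * (j * j) + 4)
    right = solve-∀

  -- The triangle inequality enters here, in the form 2j = t - s < r = a + 2.
  j≤a : j ≤ a
  j≤a = +-cancelʳ-≤ 2 j a (≤-trans (≤-trans (+-monoʳ-≤ j (s≤s 0<j)) (≤-reflexive (shift j))) 2j<a+2)
    where
    shift : ∀ j → j + suc j ≡ suc (2 * j)
    shift = solve-∀

  -- For v < j the equation reads v² = aj(j - v) + 4, hence v² > av, against v ≤ a.
  below : ∃[ o ] suc v + o ≡ j → ⊥
  below (o , refl) = <⇒≱
    (≤-witness (a * (suc (v + o) * o) + a * (o + 1) + 3)
      (trans (+-cancelˡ-≡ (a * (suc (v + o) * v)) _ _ (trans v² (distrib a v o))) (shift a v o)))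
    (*-monoˡ-≤ v v≤a)
    where
    v≤a : v ≤ a
    v≤a = ≤-trans (≤-trans (m≤m+n v o) (n≤1+n (v + o))) j≤a
    distrib : ∀ a v o → a * (suc (v + o) * suc (v + o)) + 4 ≡
      a * (suc (v + o) * v) + (a * (suc (v + o) * suc o) + 4)
    distrib = solve-∀
    shift : ∀ a v o → a * (suc (v + o) * suc o) + 4 ≡ suc (a * v) + (a * (suc (v + o) * o) + a * (o + 1) + 3)
    shift = solve-∀

  -- For v > j ≥ 1, ajv exceeds aj² and v² is at least 4, so the left side is too large. The
  -- positivity proofs are passed in so that matching turns `a` and `j` into successors.
  above : ∃[ o ] suc j + o ≡ v → 0 < a → 0 < j → ⊥
  above (o , refl) (s≤s {n = a-1} _) (s≤s {n = j-1} _) = m+1+n≢m _ (trans (sym (expand a-1 j-1 o)) v²)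
    where
    expand : ∀ α ι o → suc α * (suc ι * (suc (suc ι) + o)) + (suc (suc ι) + o) * (suc (suc ι) + o) ≡
      suc α * (suc ι * suc ι) + 4 +
        suc (α + ι + α * ι + suc α * suc ι * o + (4 * ι + ι * ι + 2 * o * (2 + ι) + o * o))
    expand = solve-∀

  compare : _ → j ≡ 2 × a * j + v ≡ a * 2 + 2
  compare (tri< v<j _ _) = ⊥-elim (below (m≤n⇒∃[o]m+o≡n v<j))
  compare (tri> _ _ v>j) = ⊥-elim (above (m≤n⇒∃[o]m+o≡n v>j) 0<a 0<j)
  compare (tri≈ _ v≡j _) with v≡j
  ... | refl with square-injective {v} {2} (+-cancelˡ-≡ (a * (v * v)) _ _ v²)
  ... | refl = refl , refl

-- Since b - a = 4, t² - s² = 4c; so t - s is even, and the triangle inequality keeps it below r = a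
-- + 2.
third-of-gap-4 : ∀ {a c s t} → 0 < a → 0 < c → s * s ≡ a * c + 4 →
  t * t ≡ (a + 4) * c + 4 → t < a + 2 + s → c ≡ a + (a + 4) + 2 * (a + 2)
third-of-gap-4 {a} {c} {s} {t} 0<a 0<c s² t² t<r+s = conclude (square-gap {s} {t} {c} (trans t² t²≡s²+4c))
  where
  t²≡s²+4c : (a + 4) * c + 4 ≡ s * s + 4 * c
  t²≡s²+4c = trans (distrib a c) (cong (_+ 4 * c) (sym s²))
    where
    distrib : ∀ a c → (a + 4) * c + 4 ≡ a * c + 4 + 4 * c
    distrib = solve-∀

  conclude : ∃[ j ] t ≡ s + 2 * j → c ≡ a + (a + 4) + 2 * (a + 2)
  conclude (j , t≡) = finish (gap-4-root 0<a 0<j 2j<a+2 (trans s² (cong (λ x → a * x + 4) c≡)))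
    where
    c≡ : c ≡ j * s + j * j
    c≡ = *-cancelˡ-≡ c (j * s + j * j) 4 (+-cancelˡ-≡ (s * s) _ _
      (trans (sym (trans t² t²≡s²+4c)) (trans (cong (λ x → x * x) t≡) (expand s j))))
      where
      expand : ∀ s j → (s + 2 * j) * (s + 2 * j) ≡ s * s + 4 * (j * s + j * j)
      expand = solve-∀

    0<j : 0 < j
    0<j = n≢0⇒n>0 λ { refl → <⇒≢ 0<c (sym c≡) }

    2j<a+2 : 2 * j < a + 2
    2j<a+2 = +-cancelˡ-< s _ _ (subst₂ _<_ t≡ (+-comm (a + 2) s) t<r+s)

    finish : j ≡ 2 × s ≡ a * 2 + 2 → c ≡ a + (a + 4) + 2 * (a + 2)
    finish (refl , refl) = trans c≡ (evaluate a)
      where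
      evaluate : ∀ a → 2 * (a * 2 + 2) + 4 ≡ a + (a + 4) + 2 * (a + 2)
      evaluate = solve-∀

-- The surplus n of rst over abc, compared with a + b + c.

-- n = (rst − abc) / 2, and e = a + b + c − n is the smaller number that extends {a, b, c}
-- to a D(4)-quadruple (e = 0 when the triple is regular).
rst-surplus : ∀ {a b c r s t} →
  r * r ≡ a * b + 4 → s * s ≡ a * c + 4 → t * t ≡ b * c + 4 →
  ∃[ n ] a * b * c * n + n * n ≡ a * b * c * (a + b + c) + 4 * (a * b + a * c + b * c) + 16
rst-surplus {a} {b} {c} {r} {s} {t} r² s² t² = conclude (square-gap {a * b * c} {r * s * t} {K} rst²)
  where
  K : ℕ
  K = a * b * c * (a + b + c) + 4 * (a * b + a * c + b * c) + 16

  rst² : r * s * t * (r * s * t) ≡ a * b * c * (a * b * c) + 4 * K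
  rst² = trans (regroup r s t) (trans (cong₂ _*_ (cong₂ _*_ r² s²) t²) (expand a b c))
    where
    regroup : ∀ r s t → r * s * t * (r * s * t) ≡ r * r * (s * s) * (t * t)
    regroup = solve-∀
    expand : ∀ a b c → (a * b + 4) * (a * c + 4) * (b * c + 4) ≡ a * b * c * (a * b * c) +
      4 * (a * b * c * (a + b + c) + 4 * (a * b + a * c + b * c) + 16)
    expand = solve-∀

  conclude : ∃[ n ] r * s * t ≡ a * b * c + 2 * n → ∃[ n ] a * b * c * n + n * n ≡ K
  conclude (n , rst≡) = n , *-cancelˡ-≡ _ K 4 (+-cancelˡ-≡ (a * b * c * (a * b * c)) _ _
    (trans (expand (a * b * c) n) (trans (cong (λ x → x * x) (sym rst≡)) rst²)))
    where
    expand : ∀ p n → p * p + 4 * (p * n + n * n) ≡ (p + 2 * n) * (p + 2 * n)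
    expand = solve-∀

-- The left side of the equation increases with `n`, and at a + b + c + 1 it already exceeds the
-- right side.
surplus≤sum : ∀ {a b c n} → 0 < a → a + 5 ≤ b → b < c →
  a * b * c * n + n * n ≡ a * b * c * (a + b + c) + 4 * (a * b + a * c + b * c) + 16 →
  n ≤ a + b + c
surplus≤sum {suc a} {n = n} 0<a a+5≤b b<c eq
  with m≤n⇒∃[o]m+o≡n a+5≤b | m≤n⇒∃[o]m+o≡n b<c
... | β , refl | γ , refl = ≮⇒≥ λ σ<n → <⇒≱ (large a β γ) (≤-trans (bound σ<n) (≤-reflexive eq))
  where
  b = suc a + 5 + β
  c = suc b + γ
  σ = suc a + b + c
  bound : σ < n → suc a * b * c * suc σ + suc σ * suc σ ≤ suc a * b * c * n + n * n
  bound σ<n = +-mono-≤ (*-monoʳ-≤ (suc a * b * c) σ<n) (*-mono-≤ σ<n σ<n)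
  large : ∀ a β γ → let b = suc a + 5 + β; c = suc b + γ; σ = suc a + b + c in
    suc a * b * c * σ + 4 * (suc a * b + suc a * c + b * c) + 16 <
    suc a * b * c * suc σ + suc σ * suc σ
  -- In the coordinates a - 1, b - a - 5 and c - b - 1 the excess is a polynomial with nonnegative
  -- coefficients.
  large a β γ = ≤-witness
    (30 + 33 * a + 13 * β + 8 * γ + 11 * a * a + 11 * a * β + 5 * a * γ + β * β + β * γ +
      γ * γ + a * a * a + 2 * a * a * β + a * a * γ + a * β * β + a * β * γ)
    (slack a β γ)
    where
    slack : ∀ a β γ → let b = suc a + 5 + β; c = suc b + γ; σ = suc a + b + c in
      suc a * b * c * suc σ + suc σ * suc σ ≡
      suc (suc a * b * c * σ + 4 * (suc a * b + suc a * c + b * c) + 16) +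
      (30 + 33 * a + 13 * β + 8 * γ + 11 * a * a + 11 * a * β + 5 * a * γ + β * β + β * γ +
        γ * γ + a * a * a + 2 * a * a * β + a * a * γ + a * β * β + a * β * γ)
    slack = solve-∀

-- With σ = a + b + c the equation says n² = abc(σ - n) + 4(ab + ac + bc) + 16. For n < σ the factor
-- σ - n is at least 1, yet n² < σ², and σ² is too small for this when c ≤ ab + a + b.
surplus<sum⇒third-large : ∀ {a b c n} → a < b → b < c → n < a + b + c →
  a * b * c * n + n * n ≡ a * b * c * (a + b + c) + 4 * (a * b + a * c + b * c) + 16 →
  a * b + a + b < c
surplus<sum⇒third-large {a} {b} {c} {n} a<b b<c n<σ eq with m≤n⇒∃[o]m+o≡n n<σ
... | o , n+o = ≰⇒> small
  where
  n² : n * n ≡ a * b * c * suc o + (4 * (a * b + a * c + b * c) + 16)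
  n² = +-cancelˡ-≡ (a * b * c * n) _ _ (trans eq (trans
    (+-assoc (a * b * c * (a + b + c)) (4 * (a * b + a * c + b * c)) 16)
    (trans (cong (λ x → a * b * c * x + (4 * (a * b + a * c + b * c) + 16)) (sym n+o))
      (distrib (a * b * c) n o (4 * (a * b + a * c + b * c) + 16)))))
    where
    distrib : ∀ p n o x → p * (suc n + o) + x ≡ p * n + (p * suc o + x)
    distrib = solve-∀

  small : ¬ c ≤ a * b + a + b
  small c≤ = <⇒≱ n²< n²≥
    where
    open ≤-Reasoning
    n²≥ : a * b * c + (4 * (a * b + a * c + b * c) + 16) ≤ n * n
    n²≥ = begin
      a * b * c + (4 * (a * b + a * c + b * c) + 16) ≤⟨ +-monoˡ-≤ _ (m≤m*n (a * b * c) (suc o)) ⟩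
      a * b * c * suc o + (4 * (a * b + a * c + b * c) + 16) ≡⟨ n² ⟨
      n * n ∎
    n²< : n * n < a * b * c + (4 * (a * b + a * c + b * c) + 16)
    n²< = begin-strict
      n * n <⟨ square-mono-< n<σ ⟩
      (a + b + c) * (a + b + c) ≡⟨ expand a b c ⟩
      c * c + (a * a + b * b) + 2 * (a * b + a * c + b * c)
        ≤⟨ +-monoˡ-≤ _ (+-mono-≤ (*-monoʳ-≤ c c≤)
            (+-mono-≤ (*-monoʳ-≤ a (<⇒≤ a<b)) (*-monoʳ-≤ b (<⇒≤ b<c)))) ⟩
      c * (a * b + a + b) + (a * b + b * c) + 2 * (a * b + a * c + b * c)
        ≤⟨ ≤-witness (a * b + a * c + 16) (slack a b c) ⟩
      a * b * c + (4 * (a * b + a * c + b * c) + 16) ∎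
      where
      expand : ∀ a b c → (a + b + c) * (a + b + c) ≡ c * c + (a * a + b * b) + 2 * (a * b + a * c + b * c)
      expand = solve-∀
      slack : ∀ a b c → a * b * c + (4 * (a * b + a * c + b * c) + 16) ≡
        c * (a * b + a + b) + (a * b + b * c) + 2 * (a * b + a * c + b * c) + (a * b + a * c + 16)
      slack = solve-∀

-- The equation reduces to (c - a - b)² = 4(ab + 4) = (2r)². The root c = a + b - 2r is excluded
-- because b < c gives a + b - c < a ≤ r.
surplus≡sum⇒regular : ∀ {a b c r} → b < c → a ≤ r → r * r ≡ a * b + 4 →
  a * b * c * (a + b + c) + (a + b + c) * (a + b + c) ≡
    a * b * c * (a + b + c) + 4 * (a * b + a * c + b * c) + 16 →
  c ≡ a + b + 2 * r
surplus≡sum⇒regular {a} {b} {c} {r} b<c a≤r r² eq = split (≤-total (a + b) c)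
  where
  σ² : (a + b + c) * (a + b + c) ≡ 4 * (a * b + a * c + b * c) + 16
  σ² = +-cancelˡ-≡ (a * b * c * (a + b + c)) _ _
    (trans eq (+-assoc (a * b * c * (a + b + c)) (4 * (a * b + a * c + b * c)) 16))

  split : a + b ≤ c ⊎ c ≤ a + b → c ≡ a + b + 2 * r
  split (inj₁ a+b≤c) with m≤n⇒∃[o]m+o≡n a+b≤c
  ... | d , refl = cong (a + b +_) (square-injective (+-cancelʳ-≡ (4 * ((a + b) * (a + b + d))) _ _
      (trans (left a b d) (trans σ² (trans (right a b d)
        (cong (_+ 4 * ((a + b) * (a + b + d))) (trans (cong (4 *_) (sym r²)) (double r))))))))
    where
    left : ∀ a b d → d * d + 4 * ((a + b) * (a + b + d)) ≡ (a + b + (a + b + d)) * (a + b + (a + b + d))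
    left = solve-∀
    right : ∀ a b d → 4 * (a * b + a * (a + b + d) + b * (a + b + d)) + 16 ≡
      4 * (a * b + 4) + 4 * ((a + b) * (a + b + d))
    right = solve-∀
    double : ∀ r → 4 * (r * r) ≡ 2 * r * (2 * r)
    double = solve-∀
  split (inj₂ c≤a+b) with m≤n⇒∃[o]m+o≡n c≤a+b
  ... | d , c+d≡ = ⊥-elim (<⇒≱ d²<4r² (≤-reflexive (sym d²≡4r²)))
    where
    d<a : d < a
    d<a = +-cancelˡ-< b d a (<-≤-trans (+-monoˡ-< d b<c) (≤-reflexive (trans c+d≡ (+-comm a b))))
    d²<4r² : d * d < 4 * (r * r)
    d²<4r² = <-≤-trans (square-mono-< (<-≤-trans d<a a≤r)) (m≤n*m (r * r) 4)
    d²≡4r² : d * d ≡ 4 * (r * r)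
    d²≡4r² = +-cancelʳ-≡ (4 * (c * (c + d))) _ _
      (trans (left c d) (trans (cong (λ x → (x + c) * (x + c)) c+d≡) (trans σ² (trans (right a b c)
        (cong₂ (λ x y → 4 * x + 4 * (c * y)) (sym r²) (sym c+d≡))))))
      where
      left : ∀ c d → d * d + 4 * (c * (c + d)) ≡ (c + d + c) * (c + d + c)
      left = solve-∀
      right : ∀ a b c → 4 * (a * b + a * c + b * c) + 16 ≡ 4 * (a * b + 4) + 4 * (c * (a + b))
      right = solve-∀

-- No triangle for a wide gap and c > ab + a + b.

-- This is (t - s)² < r² with the cross term moved across to avoid subtraction.
triangle⇒squares : ∀ {r s t} → s ≤ t → t < r + s →
  t * t + s * s < r * r + 2 * s * t
triangle⇒squares {r} {s} {t} s≤t t<r+s with m≤n⇒∃[o]m+o≡n s≤t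
... | w , refl = subst (_< r * r + 2 * s * (s + w)) (expand s w)
  (+-monoˡ-< (2 * s * (s + w)) (square-mono-< w<r))
  where
  expand : ∀ s w → w * w + 2 * s * (s + w) ≡ (s + w) * (s + w) + s * s
  expand = solve-∀
  w<r : w < r
  w<r = +-cancelˡ-< s w r (<-≤-trans t<r+s (≤-reflexive (+-comm r s)))

-- The decisive estimate for `wide-gap-degenerate`. Bounding 64 by 64c frees a factor c; then c ≥ ab
-- + a + b + 1 and d² ≥ 2(a + b) + 15 are multiplied.
wide-gap-bound : ∀ {a c d} → 0 < a → 5 ≤ d → 2 * (a + (a + d)) + 15 ≤ d * d →
  a * (a + d) + a + (a + d) < c →
  2 * (c * (a + (a + d))) * (a * (a + d) + 4) + 64 ≤ c * c * (d * d)
wide-gap-bound {suc a} {c} {d} _ 5≤d gap large with m≤n⇒∃[o]m+o≡n 5≤d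
... | β , refl = begin
  2 * (c * (suc a + b)) * (suc a * b + 4) + 64
    ≤⟨ +-monoʳ-≤ _ (m≤n*m 64 c ⦃ >-nonZero (≤-<-trans z≤n large) ⦄) ⟩
  2 * (c * (suc a + b)) * (suc a * b + 4) + c * 64
    ≡⟨ factor c (suc a + b) (suc a * b + 4) ⟩
  c * (2 * (suc a + b) * (suc a * b + 4) + 64)
    ≤⟨ *-monoʳ-≤ c (≤-witness (202 + 179 * a + 52 * β + 23 * a * a + 23 * a * β + 2 * β * β) (slack a β)) ⟩
  c * (suc (suc a * b + suc a + b) * (2 * (suc a + b) + 15))
    ≤⟨ *-monoʳ-≤ c (*-mono-≤ large gap) ⟩
  c * (c * (d * d)) ≡⟨ *-assoc c c (d * d) ⟨
  c * c * (d * d) ∎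
  where
  open ≤-Reasoning
  b = suc a + (5 + β)
  factor : ∀ c x y → 2 * (c * x) * y + c * 64 ≡ c * (2 * x * y + 64)
  factor = solve-∀
  slack : ∀ a β → let b = suc a + (5 + β) in
    suc (suc a * b + suc a + b) * (2 * (suc a + b) + 15) ≡
    2 * (suc a + b) * (suc a * b + 4) + 64 +
    (202 + 179 * a + 52 * β + 23 * a * a + 23 * a * β + 2 * β * β)
  slack = solve-∀

-- For p = t² + s² - r² the triangle inequality gives p < 2st, while the size of c forces 4s²t² ≤
-- p².
wide-gap-degenerate : ∀ {a c d r s t} → 0 < a → 5 ≤ d → 2 * (a + (a + d)) + 15 ≤ d * d →
  a * (a + d) + a + (a + d) < c →
  r * r ≡ a * (a + d) + 4 → s * s ≡ a * c + 4 → t * t ≡ (a + d) * c + 4 →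
  s ≤ t → ¬ t < r + s
wide-gap-degenerate {a} {c} {d} {r} {s} {t} 0<a 5≤d gap large r² s² t² s≤t t<r+s =
  <⇒≱ (square-mono-< p<2st) (≤-trans (≤-reflexive 4s²t²) 4s²t²≤p²)
  where
  open ≤-Reasoning
  b = a + d
  S = c * (a + b)

  4≤ab : 4 ≤ a * b
  4≤ab = ≤-trans (≤-trans (n≤1+n 4) (≤-trans 5≤d (m≤n+m d a))) (m≤n*m b a ⦃ >-nonZero 0<a ⦄)

  -- `q` is ab - 4 and `p` is `S` - `q`, both taken from witnesses of ≤ to stay within the naturals.
  q = let q , _ = m≤n⇒∃[o]m+o≡n 4≤ab in q

  ab≡4+q : 4 + q ≡ a * b
  ab≡4+q = let _ , eq = m≤n⇒∃[o]m+o≡n 4≤ab in eq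

  r²≡q+8 : r * r ≡ q + 8
  r²≡q+8 = trans r² (trans (cong (_+ 4) (sym ab≡4+q)) (shift q))
    where
    shift : ∀ q → 4 + q + 4 ≡ q + 8
    shift = solve-∀

  q≤S : q ≤ S
  q≤S = <⇒≤ (begin-strict
    q             ≤⟨ m≤n+m q 4 ⟩
    4 + q         ≡⟨ ab≡4+q ⟩
    a * b         ≤⟨ m≤m+n (a * b) (a + b) ⟩
    a * b + (a + b) ≡⟨ +-assoc (a * b) a b ⟨
    a * b + a + b <⟨ large ⟩
    c             ≤⟨ m≤m*n c (a + b) ⦃ >-nonZero (<-≤-trans 0<a (m≤m+n a b)) ⦄ ⟩
    S             ∎)

  p = let p , _ = m≤n⇒∃[o]m+o≡n q≤S in p

  q+p≡S : q + p ≡ S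
  q+p≡S = let _ , eq = m≤n⇒∃[o]m+o≡n q≤S in eq

  p<2st : p < 2 * s * t
  p<2st = +-cancelˡ-< (q + 8) p _ (subst₂ _<_ t²+s² (cong (_+ 2 * s * t) r²≡q+8)
    (triangle⇒squares s≤t t<r+s))
    where
    t²+s² : t * t + s * s ≡ q + 8 + p
    t²+s² = trans (cong₂ _+_ t² s²) (trans (collect a b c) (trans (cong (_+ 8) (sym q+p≡S)) (swap q p)))
      where
      collect : ∀ a b c → b * c + 4 + (a * c + 4) ≡ c * (a + b) + 8
      collect = solve-∀
      swap : ∀ q p → q + p + 8 ≡ q + 8 + p
      swap = solve-∀

  4s²t² : 2 * s * t * (2 * s * t) ≡ 4 * ((a * c + 4) * (b * c + 4))
  4s²t² = trans (regroup s t) (cong₂ (λ x y → 4 * (x * y)) s² t²)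
    where
    regroup : ∀ s t → 2 * s * t * (2 * s * t) ≡ 4 * (s * s * (t * t))
    regroup = solve-∀

  -- Adding 2qS to p² = (S - q)² leaves S² + q², and S² = c²(4ab + d²) because d = b - a.
  4s²t²≤p² : 4 * ((a * c + 4) * (b * c + 4)) ≤ p * p
  4s²t²≤p² = +-cancelˡ-≤ (2 * q * S) _ _ (begin
    2 * q * S + 4 * ((a * c + 4) * (b * c + 4))
      ≡⟨ expand a b c q ⟩
    4 * (a * b) * (c * c) + (2 * S * (q + 8) + 64)
      ≡⟨ cong (λ x → 4 * (a * b) * (c * c) + (2 * S * x + 64)) (trans (sym r²≡q+8) r²) ⟩
    4 * (a * b) * (c * c) + (2 * S * (a * b + 4) + 64)
      ≤⟨ +-monoʳ-≤ (4 * (a * b) * (c * c)) (wide-gap-bound 0<a 5≤d gap large) ⟩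
    4 * (a * b) * (c * c) + c * c * (d * d)
      ≡⟨ square a c d ⟩
    S * S
      ≤⟨ m≤m+n (S * S) (q * q) ⟩
    S * S + q * q
      ≡⟨ cong (λ x → x * x + q * q) q+p≡S ⟨
    (q + p) * (q + p) + q * q
      ≡⟨ rearrange q p ⟩
    2 * q * (q + p) + p * p
      ≡⟨ cong (λ x → 2 * q * x + p * p) q+p≡S ⟩
    2 * q * S + p * p ∎)
    where
    expand : ∀ a b c q → 2 * q * (c * (a + b)) + 4 * ((a * c + 4) * (b * c + 4)) ≡
      4 * (a * b) * (c * c) + (2 * (c * (a + b)) * (q + 8) + 64)
    expand = solve-∀
    square : ∀ a c d → 4 * (a * (a + d)) * (c * c) + c * c * (d * d) ≡
      c * (a + (a + d)) * (c * (a + (a + d)))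
    square = solve-∀
    rearrange : ∀ q p → (q + p) * (q + p) + q * q ≡ 2 * q * (q + p) + p * p
    rearrange = solve-∀

-- Similarity as proportionality of ordered sides.

clear-denominators : ∀ {k} m n → Positive k → (ℤ.+ m) ℚ./ 1 ≡ k ℚ.* ((ℤ.+ n) ℚ./ 1) →
  ℚ.↧ₙ k * m ≡ ℤ.∣ ℚ.↥ k ∣ * n
clear-denominators {k@(mkℚ +[1+ p ] q-1 _)} m n _ eq =
  cross-multiply (ℚᵘ.≃-trans (ℚᵘ.≃-sym (toℚᵘ-fromℚᵘ (mkℚᵘ (ℤ.+ m) 0)))
    (ℚᵘ.≃-trans (toℚᵘ-cong eq) (ℚᵘ.≃-trans (toℚᵘ-homo-* k ((ℤ.+ n) ℚ./ 1))
      (ℚᵘ.*-congˡ {toℚᵘ k} (toℚᵘ-fromℚᵘ (mkℚᵘ (ℤ.+ n) 0))))))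
  where
  open ≡-Reasoning
  cross-multiply : mkℚᵘ (ℤ.+ m) 0 ℚᵘ.≃ toℚᵘ k ℚᵘ.* mkℚᵘ (ℤ.+ n) 0 → suc q-1 * m ≡ suc p * n
  cross-multiply (*≡* x) = begin
    suc q-1 * m                                ≡⟨ *-comm (suc q-1) m ⟩
    m * suc q-1                                ≡⟨ cong (m *_) (*-identityʳ (suc q-1)) ⟨
    m * (suc q-1 * 1)                          ≡⟨ ℤ.abs-* (ℤ.+ m) (ℤ.+ (suc q-1 * 1)) ⟨
    ℤ.∣ (ℤ.+ m) ℤ.* (ℤ.+ (suc q-1 * 1)) ∣          ≡⟨ cong ℤ.∣_∣ x ⟩
    ℤ.∣ (+[1+ p ] ℤ.* (ℤ.+ n)) ℤ.* (ℤ.+ 1) ∣       ≡⟨ cong ℤ.∣_∣ (ℤ.*-identityʳ (+[1+ p ] ℤ.* (ℤ.+ n))) ⟩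
    ℤ.∣ +[1+ p ] ℤ.* (ℤ.+ n) ∣                   ≡⟨ ℤ.abs-* +[1+ p ] (ℤ.+ n) ⟩
    suc p * n                                  ∎

increasing⇒identity : ∀ (f : Fin 3 → Fin 3) →
  f zero Fin.< f (suc zero) → f (suc zero) Fin.< f (suc (suc zero)) → ∀ i → f i ≡ i
increasing⇒identity f f₀<f₁ f₁<f₂ i with search (f zero) (f (suc zero)) (f (suc (suc zero))) f₀<f₁ f₁<f₂
  where
  search : ∀ (x y z : Fin 3) → x Fin.< y → y Fin.< z → x ≡ zero × y ≡ suc zero × z ≡ suc (suc zero)
  search = from-yes (all? {n = 3} λ x → all? {n = 3} λ y → all? {n = 3} λ z →
    (x Fin.<? y) →-dec (y Fin.<? z) →-dec ((x Fin.≟ zero) ×-dec (y Fin.≟ suc zero) ×-dec (z Fin.≟ suc (suc zero))))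
... | f₀ , f₁ , f₂ with i
... | zero = f₀
... | suc zero = f₁
... | suc (suc zero) = f₂

sides-cancel-< : ∀ {x y z} → x < y → y < z → ∀ i j → sides x y z i < sides x y z j → i Fin.< j
sides-cancel-< x<y y<z zero zero lt = ⊥-elim (<-irrefl refl lt)
sides-cancel-< x<y y<z zero (suc j) lt = z<s
sides-cancel-< x<y y<z (suc zero) zero lt = ⊥-elim (<-asym x<y lt)
sides-cancel-< x<y y<z (suc zero) (suc zero) lt = ⊥-elim (<-irrefl refl lt)
sides-cancel-< x<y y<z (suc zero) (suc (suc zero)) lt = s≤s z<s
sides-cancel-< x<y y<z (suc (suc zero)) zero lt = ⊥-elim (<-asym (<-trans x<y y<z) lt)
sides-cancel-< x<y y<z (suc (suc zero)) (suc zero) lt = ⊥-elim (<-asym y<z lt)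
sides-cancel-< x<y y<z (suc (suc zero)) (suc (suc zero)) lt = ⊥-elim (<-irrefl refl lt)

-- A positive ratio preserves the order of the sides, so the permutation is increasing and hence the
-- identity.
similar⇒proportional : ∀ {x y z x′ y′ z′} → x < y → y < z → x′ < y′ → y′ < z′ →
  Similar (sides x y z) (sides x′ y′ z′) →
  ∃[ q ] ∃[ p ] suc q * x′ ≡ suc p * x × suc q * y′ ≡ suc p * y × suc q * z′ ≡ suc p * z
-- A rational stores its denominator minus one, so the ratio is `suc p` over `suc q`.
similar⇒proportional {x} {y} {z} {x′} {y′} {z′} x<y y<z x′<y′ y′<z′ (σ , mkℚ +[1+ p ] q _ , k>0 , ratio) =
  q , p , side zero , side (suc zero) , side (suc (suc zero))
  where
  T = sides x y z
  T′ = sides x′ y′ z′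

  scale : ∀ i → suc q * T′ (σ ⟨$⟩ʳ i) ≡ suc p * T i
  scale i = clear-denominators (T′ (σ ⟨$⟩ʳ i)) (T i) k>0 (ratio i)

  σ-mono : ∀ i j → T i < T j → (σ ⟨$⟩ʳ i) Fin.< (σ ⟨$⟩ʳ j)
  σ-mono i j Tᵢ<Tⱼ = sides-cancel-< x′<y′ y′<z′ _ _ (*-cancelˡ-< (suc q) _ _
    (subst₂ _<_ (sym (scale i)) (sym (scale j)) (*-monoʳ-< (suc p) Tᵢ<Tⱼ)))

  side : ∀ i → suc q * T′ i ≡ suc p * T i
  side i = subst (λ j → suc q * T′ j ≡ suc p * T i)
    (increasing⇒identity (σ ⟨$⟩ʳ_) (σ-mono zero (suc zero) x<y) (σ-mono (suc zero) (suc (suc zero)) y<z) i)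
    (scale i)

-- Subtracting the relation for r from the other two scales a and b as well. Then q²r′² = p²r²
-- expands with equal terms q²a′b′ = p²ab, leaving 4q² = 4p².
proportional-regular⇒equal : ∀ {a b r a′ b′ r′} q p →
  r * r ≡ a * b + 4 → r′ * r′ ≡ a′ * b′ + 4 →
  q * r′ ≡ p * r → q * (a′ + r′) ≡ p * (a + r) → q * (b′ + r′) ≡ p * (b + r) → q ≡ p
proportional-regular⇒equal {a} {b} {r} {a′} {b′} {r′} q p r² r′² r~ s~ t~ =
  square-injective (*-cancelʳ-≡ (q * q) (p * p) 4 (+-cancelˡ-≡ (q * a′ * (q * b′)) _ _ (begin
    q * a′ * (q * b′) + q * q * 4   ≡⟨ factor q a′ b′ ⟩
    q * q * (a′ * b′ + 4)           ≡⟨ cong ((q * q) *_) r′² ⟨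
    q * q * (r′ * r′)               ≡⟨ squares q r′ ⟩
    q * r′ * (q * r′)               ≡⟨ cong₂ _*_ r~ r~ ⟩
    p * r * (p * r)                 ≡⟨ squares p r ⟨
    p * p * (r * r)                 ≡⟨ cong ((p * p) *_) r² ⟩
    p * p * (a * b + 4)             ≡⟨ factor p a b ⟨
    p * a * (p * b) + p * p * 4     ≡⟨ cong₂ (λ x y → x * y + p * p * 4) (difference s~) (difference t~) ⟨
    q * a′ * (q * b′) + p * p * 4   ∎)))
  where
  open ≡-Reasoning
  factor : ∀ q a b → q * a * (q * b) + q * q * 4 ≡ q * q * (a * b + 4)
  factor = solve-∀
  squares : ∀ q r → q * q * (r * r) ≡ q * r * (q * r)
  squares = solve-∀
  difference : ∀ {x x′} → q * (x′ + r′) ≡ p * (x + r) → q * x′ ≡ p * x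
  difference {x} {x′} eq = +-cancelʳ-≡ (p * r) _ _ (begin
    q * x′ + p * r    ≡⟨ cong ((q * x′) +_) r~ ⟨
    q * x′ + q * r′   ≡⟨ *-distribˡ-+ q x′ r′ ⟨
    q * (x′ + r′)     ≡⟨ eq ⟩
    p * (x + r)       ≡⟨ *-distribˡ-+ p x r ⟩
    p * x + p * r     ∎)

-- Regularity of the triple and the final comparison.

-- The surplus n is at most a + b + c: equality gives regularity, and a smaller n makes c so large
-- that the triangle cannot exist.
wide-gap⇒regular : ∀ {a c d r s t} → 0 < a → 2 * (a + (a + d)) + 15 ≤ d * d → a + d < c →
  r * r ≡ a * (a + d) + 4 → s * s ≡ a * c + 4 → t * t ≡ (a + d) * c + 4 → t < r + s →
  c ≡ a + (a + d) + 2 * r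
wide-gap⇒regular {a} {c} {d} {r} {s} {t} 0<a gap b<c r² s² t² t<r+s =
  conclude (rst-surplus {a} {b} {c} {r} {s} {t} r² s² t²)
  where
  b = a + d
  -- For d ≤ 4 the gap hypothesis would give 17 ≤ 16.
  5≤d : 5 ≤ d
  5≤d = ≰⇒> λ d≤4 → <⇒≱ 16<17 (≤-trans (+-monoˡ-≤ 15 2≤2σ) (≤-trans gap (*-mono-≤ d≤4 d≤4)))
    where
    16<17 : 4 * 4 < 2 + 15
    16<17 = ≤-refl
    2≤2σ : 2 ≤ 2 * (a + b)
    2≤2σ = *-monoʳ-≤ 2 {1} {a + b} (≤-trans 0<a (m≤m+n a b))
  s≤t : s ≤ t
  s≤t = square-cancel-≤ (subst₂ _≤_ (sym s²) (sym t²) (+-monoˡ-≤ 4 (*-monoˡ-≤ c (m≤m+n a d))))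
  a≤r : a ≤ r
  a≤r = square-cancel-≤ (subst (a * a ≤_) (sym r²) (≤-trans (*-monoʳ-≤ a (m≤m+n a d)) (m≤m+n (a * b) 4)))
  conclude : ∃[ n ] a * b * c * n + n * n ≡ a * b * c * (a + b + c) + 4 * (a * b + a * c + b * c) + 16 →
    c ≡ a + b + 2 * r
  conclude (n , eq) with m≤n⇒m<n∨m≡n (surplus≤sum {a} {b} {c} {n} 0<a (+-monoʳ-≤ a 5≤d) b<c eq)
  ... | inj₂ refl = surplus≡sum⇒regular {a} {b} {c} {r} b<c a≤r r² eq
  ... | inj₁ n<σ = ⊥-elim (wide-gap-degenerate {a} {c} {d} {r} {s} {t} 0<a 5≤d gap
    (surplus<sum⇒third-large {a} {b} {c} {n} (m<m+n a (<-≤-trans z<s 5≤d)) b<c n<σ eq) r² s² t² s≤t t<r+s)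

regular : ∀ {a b c r s t} → IsAssociatedTriangle a b c r s t → c ≡ a + b + 2 * r
regular {a} {b} {c} {r} {s} {t} T = go (pair-cases {r = r} a-positive a<b r≡√)
  where
  open IsAssociatedTriangle T
  open IsD4Triple isD4Triple
  go : (a ≡ 3 × b ≡ 4) ⊎ (b ≡ a + 4 × r ≡ a + 2) ⊎ (∃[ d ] b ≡ a + d × 2 * (a + (a + d)) + 15 ≤ d * d) →
    c ≡ a + b + 2 * r
  go (inj₁ (refl , refl)) with square-injective {r} {4} r≡√
  ... | refl = third-of-3-4 {c} {s} {t} c-positive s≡√ t≡√ exists
  go (inj₂ (inj₁ (refl , refl))) = third-of-gap-4 {a} {c} {s} {t} a-positive c-positive s≡√ t≡√ exists
  go (inj₂ (inj₂ (d , refl , gap))) = wide-gap⇒regular {a} {c} {d} {r} {s} {t} a-positive gap b<c r≡√ s≡√ t≡√ exists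

-- Replacing xy + 4 by r² completes the square (x + r)².
square-side : ∀ {x y r s} → r * r ≡ x * y + 4 → s * s ≡ x * (x + y + 2 * r) + 4 → s ≡ x + r
square-side {x} {y} {r} {s} r² s² = square-injective {s} {x + r} (trans s² (trans (expand x y r)
  (trans (cong (λ z → x * x + 2 * x * r + z) (sym r²)) (collect x r))))
  where
  expand : ∀ x y r → x * (x + y + 2 * r) + 4 ≡ x * x + 2 * x * r + (x * y + 4)
  expand = solve-∀
  collect : ∀ x r → x * x + 2 * x * r + r * r ≡ (x + r) * (x + r)
  collect = solve-∀

regular-sides : ∀ {a b c r s t} → IsAssociatedTriangle a b c r s t → s ≡ a + r × t ≡ b + r
regular-sides {a} {b} {c} {r} T =
  square-side {a} {b} {r} r≡√ (trans s≡√ (cong (λ x → a * x + 4) (regular T))) ,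
  square-side {b} {a} {r} (trans r≡√ (cong (_+ 4) (*-comm a b)))
    (trans t≡√ (cong (λ x → b * x + 4) (trans (regular T) (cong (_+ 2 * r) (+-comm a b)))))
  where open IsAssociatedTriangle T

proposition4p5 : ∀ {a b c r s t a′ b′ c′ r′ s′ t′ : ℕ} →
    IsAssociatedTriangle a b c r s t →
    IsAssociatedTriangle a′ b′ c′ r′ s′ t′ →
    Similar (sides r s t) (sides r′ s′ t′) →
    Congruent (sides r s t) (sides r′ s′ t′)
proposition4p5 {a} {b} {r = r} {s} {t} {a′} {b′} {r′ = r′} {s′} {t′} T T′ similar =
  conclude (regular-sides T) (regular-sides T′) similar
  where
  open IsAssociatedTriangle T
  open IsD4Triple isD4Triple
  open IsAssociatedTriangle T′ using () renaming (isD4Triple to isD4Triple′; a<b to a′<b′; r≡√ to r′≡√)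
  open IsD4Triple isD4Triple′ using () renaming (a-positive to a′-positive)

  equal-scale : ∃[ q ] ∃[ p ]
    suc q * r′ ≡ suc p * r × suc q * (a′ + r′) ≡ suc p * (a + r) × suc q * (b′ + r′) ≡ suc p * (b + r) →
    Congruent (sides r (a + r) (b + r)) (sides r′ (a′ + r′) (b′ + r′))
  -- Matching identifies numerator and denominator, so a common factor cancels from each pair of
  -- sides.
  equal-scale (q , p , r~ , s~ , t~)
    with refl ← proportional-regular⇒equal {a} {b} {r} {a′} {b′} {r′} (suc q) (suc p) r≡√ r′≡√ r~ s~ t~ =
    Permutation.id , λ where
      zero → *-cancelˡ-≡ _ _ (suc q) r~
      (suc zero) → *-cancelˡ-≡ _ _ (suc q) s~
      (suc (suc zero)) → *-cancelˡ-≡ _ _ (suc q) t~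

  conclude : s ≡ a + r × t ≡ b + r → s′ ≡ a′ + r′ × t′ ≡ b′ + r′ →
    Similar (sides r s t) (sides r′ s′ t′) → Congruent (sides r s t) (sides r′ s′ t′)
  -- With sides r, a + r, b + r, their order follows from a > 0 and a < b.
  conclude (refl , refl) (refl , refl) similar = equal-scale
    (similar⇒proportional (m<n+m r a-positive) (+-monoˡ-< r a<b)
      (m<n+m r′ a′-positive) (+-monoˡ-< r′ a′<b′) similar)
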